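{- For all non-negative integers $n$ and $l$ and for all positive integers $m$, the integer $$\Psi(2n,m,l)=\sum_{k=0}^{2n}(-1)^k\binom{2n}{k}^m S(k,l)\,S(2n-k,l)$$ is divisible by $S(n,l)$.
   Context: For non-negative integers $a$ and $b$, the super Catalan number is $S(a,b)=\dfrac{\binom{2a}{a}\binom{2b}{b}}{\binom{a+b}{a}}=\dfrac{(2a)!\,(2b)!}{a!\,b!\,(a+b)!}$; it is always an integer. Divisibility is in the ring of integers. -}

module Defs where

open import Data.Nat.Base as ℕ using (ℕ; zero; suc; _∸_; _!; NonZero)
open import Data.Nat.Combinatorics using (_C_; nCk≡n!/k![n-k]!; k![n∸k]!∣n!)
open import Data.Nat.Divisibility using (_∣_; divides; ∣m+n∣m⇒∣n; *-monoʳ-∣)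
open import Data.Nat.DivMod using (_/_; m/n*n≡m)
open import Data.Nat.Properties
  using (_!≢0; _!*_!≢0; m*n≢0; *-suc; +-suc; +-identityʳ; *-identityʳ; m≤m+n; m+n∸m≡n; *-cancelʳ-≡)
open import Data.Nat.Solver using (module +-*-Solver)
open import Data.Integer.Base using (ℤ; +_; -1ℤ; _*_; _^_)
open import Data.Integer.Properties using (+-*-semiring)
open import Data.Fin.Base using (toℕ)
open import Algebra.Properties.Semiring.Sum +-*-semiring using (sum⁺-syntax)
open import Relation.Binary.PropositionalEquality
  using (_≡_; refl; sym; trans; cong; cong₂; subst; subst₂; module ≡-Reasoning)

superNum superDen : ℕ → ℕ → ℕ
superNum a b = (2 ℕ.* a) ! ℕ.* (2 ℕ.* b) !
superDen a b = (a ! ℕ.* b !) ℕ.* (a ℕ.+ b) !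

superDen≢0 : ∀ a b → NonZero (superDen a b)
superDen≢0 a b = m*n≢0 _ _ {{a !* b !≢0}} {{(a ℕ.+ b) !≢0}}

-- Truncating division; it is exact by S*superDen≡superNum below.
S : ℕ → ℕ → ℕ
S a b = (superNum a b / superDen a b) {{superDen≢0 a b}}

-- The alternating signs and the sum live in ℤ; the truncated subtraction is
-- exact because k ranges over 0, …, N.
Ψ : ℕ → ℕ → ℕ → ℤ
Ψ N m l = ∑[ k ≤ N ]
  (-1ℤ ^ toℕ k * (+ (N C toℕ k)) ^ m * + S (toℕ k) l * + S (N ∸ toℕ k) l)

private
  m!n!∣[m+n]! : ∀ m n → m ! ℕ.* n ! ∣ (m ℕ.+ n) !
  m!n!∣[m+n]! m n = subst (λ t → m ! ℕ.* t ! ∣ (m ℕ.+ n) !) (m+n∸m≡n m n)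
    (k![n∸k]!∣n! (m≤m+n m n))

  C*m!n!≡[m+n]! : ∀ m n → ((m ℕ.+ n) C m) ℕ.* (m ! ℕ.* n !) ≡ (m ℕ.+ n) !
  C*m!n!≡[m+n]! m n = begin
    ((m ℕ.+ n) C m) ℕ.* (m ! ℕ.* n !)
      ≡⟨ cong (λ t → ((m ℕ.+ n) C m) ℕ.* (m ! ℕ.* t !)) (m+n∸m≡n m n) ⟨
    ((m ℕ.+ n) C m) ℕ.* (m ! ℕ.* ((m ℕ.+ n) ∸ m) !)
      ≡⟨ cong (ℕ._* (m ! ℕ.* ((m ℕ.+ n) ∸ m) !)) (nCk≡n!/k![n-k]! (m≤m+n m n)) ⟩
    ((m ℕ.+ n) ! / (m ! ℕ.* ((m ℕ.+ n) ∸ m) !)) ℕ.* (m ! ℕ.* ((m ℕ.+ n) ∸ m) !)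
      ≡⟨ m/n*n≡m (k![n∸k]!∣n! (m≤m+n m n)) ⟩
    (m ℕ.+ n) ! ∎
    where
    open ≡-Reasoning
    instance _ = m !* ((m ℕ.+ n) ∸ m) !≢0

  C*n!n!≡[2n]! : ∀ n → ((2 ℕ.* n) C n) ℕ.* (n ! ℕ.* n !) ≡ (2 ℕ.* n) !
  C*n!n!≡[2n]! n = subst (λ t → (t C n) ℕ.* (n ! ℕ.* n !) ≡ t !)
    (cong (n ℕ.+_) (sym (+-identityʳ n))) (C*m!n!≡[m+n]! n n)

  [2[1+n]]! : ∀ n → (2 ℕ.* suc n) ! ≡
    (2 ℕ.+ 2 ℕ.* n) ℕ.* ((1 ℕ.+ 2 ℕ.* n) ℕ.* (2 ℕ.* n) !)
  [2[1+n]]! n = cong _! (*-suc 2 n)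

-- Integrality, by induction on b through 4 S(a,b) = S(a+1,b) + S(a,b+1).
superDen∣superNum : ∀ a b → superDen a b ∣ superNum a b
superDen∣superNum a zero = subst₂ _∣_
  (sym (trans (cong (λ t → a ! ℕ.* 1 ℕ.* t !) (+-identityʳ a)) (cong (ℕ._* a !) (*-identityʳ (a !)))))
  (trans (cong (λ t → (a ℕ.+ t) !) (sym (+-identityʳ a))) (sym (*-identityʳ ((2 ℕ.* a) !))))
  (m!n!∣[m+n]! a a)
superDen∣superNum a (suc b) with superDen∣superNum a b | superDen∣superNum (suc a) b
... | divides q eq | divides r eq′ = subst₂ _∣_ den num
      (*-monoʳ-∣ (suc b ℕ.* superDen a b) s∣B)
  where
  open ≡-Reasoning
  open +-*-Solver
  s A B : ℕ
  s = suc (a ℕ.+ b)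
  A = 2 ℕ.* (1 ℕ.+ 2 ℕ.* a) ℕ.* q
  B = 2 ℕ.* (1 ℕ.+ 2 ℕ.* b) ℕ.* q

  instance
    _ = m*n≢0 (suc a) (superDen a b) {{_}} {{superDen≢0 a b}}

  rs≡A : r ℕ.* s ≡ A
  rs≡A = *-cancelʳ-≡ _ _ (suc a ℕ.* superDen a b) (begin
    r ℕ.* s ℕ.* (suc a ℕ.* superDen a b)
      ≡⟨ solve 6 (λ r s a x y z → r :* s :* (a :* (x :* y :* z)) := r :* (a :* x :* y :* (s :* z)))
           refl r s (suc a) (a !) (b !) ((a ℕ.+ b) !) ⟩
    r ℕ.* superDen (suc a) b
      ≡⟨ eq′ ⟨
    superNum (suc a) b
      ≡⟨ cong (ℕ._* (2 ℕ.* b) !) ([2[1+n]]! a) ⟩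
    (2 ℕ.+ 2 ℕ.* a) ℕ.* ((1 ℕ.+ 2 ℕ.* a) ℕ.* (2 ℕ.* a) !) ℕ.* (2 ℕ.* b) !
      ≡⟨ solve 3 (λ a x y → (con 2 :+ con 2 :* a) :* ((con 1 :+ con 2 :* a) :* x) :* y
                  := con 2 :* (con 1 :+ con 2 :* a) :* (con 1 :+ a) :* (x :* y))
           refl a ((2 ℕ.* a) !) ((2 ℕ.* b) !) ⟩
    2 ℕ.* (1 ℕ.+ 2 ℕ.* a) ℕ.* suc a ℕ.* superNum a b
      ≡⟨ cong (2 ℕ.* (1 ℕ.+ 2 ℕ.* a) ℕ.* suc a ℕ.*_) eq ⟩
    2 ℕ.* (1 ℕ.+ 2 ℕ.* a) ℕ.* suc a ℕ.* (q ℕ.* superDen a b)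
      ≡⟨ solve 4 (λ c a q d → c :* a :* (q :* d) := c :* q :* (a :* d))
           refl (2 ℕ.* (1 ℕ.+ 2 ℕ.* a)) (suc a) q (superDen a b) ⟩
    A ℕ.* (suc a ℕ.* superDen a b) ∎)

  s∣A+B : s ∣ A ℕ.+ B
  s∣A+B = divides (4 ℕ.* q)
    (solve 3 (λ a b q → con 2 :* (con 1 :+ con 2 :* a) :* q :+ con 2 :* (con 1 :+ con 2 :* b) :* q
               := con 4 :* q :* (con 1 :+ (a :+ b)))
       refl a b q)

  s∣B : s ∣ B
  s∣B = ∣m+n∣m⇒∣n s∣A+B (divides r (sym rs≡A))

  den : suc b ℕ.* superDen a b ℕ.* s ≡ superDen a (suc b)
  den = begin
    suc b ℕ.* superDen a b ℕ.* s
      ≡⟨ solve 5 (λ s b x y z → b :* (x :* y :* z) :* s := x :* (b :* y) :* (s :* z))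
           refl s (suc b) (a !) (b !) ((a ℕ.+ b) !) ⟩
    a ! ℕ.* suc b ! ℕ.* s !
      ≡⟨ cong (λ t → a ! ℕ.* suc b ! ℕ.* t !) (+-suc a b) ⟨
    superDen a (suc b) ∎

  num : suc b ℕ.* superDen a b ℕ.* B ≡ superNum a (suc b)
  num = begin
    suc b ℕ.* superDen a b ℕ.* B
      ≡⟨ solve 4 (λ b d c q → b :* d :* (c :* q) := b :* c :* (q :* d))
           refl (suc b) (superDen a b) (2 ℕ.* (1 ℕ.+ 2 ℕ.* b)) q ⟩
    suc b ℕ.* (2 ℕ.* (1 ℕ.+ 2 ℕ.* b)) ℕ.* (q ℕ.* superDen a b)
      ≡⟨ cong (suc b ℕ.* (2 ℕ.* (1 ℕ.+ 2 ℕ.* b)) ℕ.*_) eq ⟨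
    suc b ℕ.* (2 ℕ.* (1 ℕ.+ 2 ℕ.* b)) ℕ.* superNum a b
      ≡⟨ solve 3 (λ b x y → (con 1 :+ b) :* (con 2 :* (con 1 :+ con 2 :* b)) :* (x :* y)
                  := x :* ((con 2 :+ con 2 :* b) :* ((con 1 :+ con 2 :* b) :* y)))
           refl b ((2 ℕ.* a) !) ((2 ℕ.* b) !) ⟩
    (2 ℕ.* a) ! ℕ.* ((2 ℕ.+ 2 ℕ.* b) ℕ.* ((1 ℕ.+ 2 ℕ.* b) ℕ.* (2 ℕ.* b) !))
      ≡⟨ cong ((2 ℕ.* a) ! ℕ.*_) ([2[1+n]]! b) ⟨
    superNum a (suc b) ∎

S*superDen≡superNum : ∀ a b → S a b ℕ.* superDen a b ≡ superNum a b
S*superDen≡superNum a b = m/n*n≡m {{superDen≢0 a b}} (superDen∣superNum a b)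

S-binomial : ∀ a b →
  S a b ℕ.* ((a ℕ.+ b) C a) ≡ ((2 ℕ.* a) C a) ℕ.* ((2 ℕ.* b) C b)
S-binomial a b = *-cancelʳ-≡ _ _ (x ℕ.* y ℕ.* (x ℕ.* y)) (begin
  S a b ℕ.* c ℕ.* (x ℕ.* y ℕ.* (x ℕ.* y))
    ≡⟨ solve 3 (λ s c p → s :* c :* (p :* p) := s :* (p :* (c :* p))) refl (S a b) c (x ℕ.* y) ⟩
  S a b ℕ.* (x ℕ.* y ℕ.* (c ℕ.* (x ℕ.* y)))
    ≡⟨ cong (λ t → S a b ℕ.* (x ℕ.* y ℕ.* t)) (C*m!n!≡[m+n]! a b) ⟩
  S a b ℕ.* superDen a b
    ≡⟨ S*superDen≡superNum a b ⟩
  superNum a b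
    ≡⟨ cong₂ ℕ._*_ (C*n!n!≡[2n]! a) (C*n!n!≡[2n]! b) ⟨
  (d ℕ.* (x ℕ.* x)) ℕ.* (e ℕ.* (y ℕ.* y))
    ≡⟨ solve 4 (λ d e x y → d :* (x :* x) :* (e :* (y :* y)) := d :* e :* (x :* y :* (x :* y)))
         refl d e x y ⟩
  d ℕ.* e ℕ.* (x ℕ.* y ℕ.* (x ℕ.* y)) ∎)
  where
  open ≡-Reasoning
  open +-*-Solver
  x y c d e : ℕ
  x = a !
  y = b !
  c = (a ℕ.+ b) C a
  d = (2 ℕ.* a) C a
  e = (2 ℕ.* b) C b
  instance _ = m*n≢0 (x ℕ.* y) (x ℕ.* y) {{a !* b !≢0}} {{a !* b !≢0}}

{-# OPTIONS --safe #-}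
module Submission where

-- Write V_j(a,b) = C(a,j) C(b,j) and U_j(a,b) = C(a+b,a) V_j(a,b), where a = k and b = 2n − k.
-- By Vandermonde, C(a+b,a) V_j is a combination of the V_i whose coefficients depend on a + b
-- only, so the m-th power of C(2n,k) is an integer combination of the U_j and it suffices that
-- S(n,l) divides ∑ (−1)^a U_j(a,b) S(a,l) S(b,l) for each j.  That sum is a terminating
-- well-poised ₃F₂(1), and Dixon's theorem gives, for j ≤ n,
--   (−1)^j S(n,l) S(n+l−j,n) C(n,j) C(2j,j).
-- This evaluation is proved by descent on j from j = n, where only a = b = n contributes, with
-- a first-order recurrence in j coming from a telescoping certificate.

open import Defs
open import Algebra.Bundles using (AbelianGroup)
open import Data.Fin.Base as Fin using (Fin; toℕ)
open import Data.Fin.Properties using (toℕ≤pred[n])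
open import Data.Integer.Base using (ℤ; +_; 0ℤ; 1ℤ; -1ℤ; _+_; _-_; _*_; _^_)
open import Data.Integer.Divisibility.Signed
  using (_∣_; divides; ∣m∣n⇒∣m+n; ∣m⇒∣m*n; ∣n⇒∣m*n)
open import Data.Integer.Properties
  using ( +-*-semiring; +-0-abelianGroup; pos-*; +-identityˡ; +-identityʳ; +-comm
        ; *-comm; *-identityˡ; *-zeroʳ; *-distribˡ-+; *-distribʳ-+; *-cancelˡ-≡)
open import Data.Integer.Solver using (module +-*-Solver)
open import Data.Nat.Base as ℕ using (ℕ; zero; suc; _!; NonZero; z≤n; s≤s)
open import Data.Nat.Combinatorics
  using (_C_; nC1≡n; nCn≡1; nCk≡nC[n∸k]; k>n⇒nCk≡0; nCk+nC[k+1]≡[n+1]C[k+1])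
import Data.Nat.Properties as ℕₚ
import Data.Nat.Solver as ℕ
open import Data.Product.Base using (_,_)
open import Relation.Binary.PropositionalEquality
  using (_≡_; refl; sym; trans; cong; cong₂; subst; module ≡-Reasoning)
open import Relation.Nullary using (yes; no; contradiction)
open import Algebra.Properties.Group (AbelianGroup.group +-0-abelianGroup)
  using () renaming (∙-cancelˡ to +-cancelˡ-≡)
open import Algebra.Properties.Semiring.Sum +-*-semiring
open ≡-Reasoning
open +-*-Solver

-- Binomial coefficients

c : ℕ → ℕ → ℤ
c n k = + (n C k)

c-pascal : ∀ n k → c (suc n) (suc k) ≡ c n k + c n (suc k)
c-pascal n k = sym (cong +_ (nCk+nC[k+1]≡[n+1]C[k+1] n k))

c-zero : ∀ {n k} → n ℕ.< k → c n k ≡ 0ℤ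
c-zero n<k = cong +_ (k>n⇒nCk≡0 n<k)

-- The difference lives in ℤ, so the identity also covers k ≥ n, where both sides vanish. Pascal's
-- rule reduces row n + 1 to row n at k and at k + 1.
c-lower : ∀ n k → + suc k * c n (suc k) ≡ (+ n - + k) * c n k
c-lower zero zero = refl
c-lower zero (suc k) = begin
  + suc (suc k) * c 0 (suc (suc k)) ≡⟨ cong (+ suc (suc k) *_) (c-zero {0} {suc (suc k)} (s≤s z≤n)) ⟩
  + suc (suc k) * 0ℤ                ≡⟨ *-zeroʳ (+ suc (suc k)) ⟩
  0ℤ                                ≡⟨ *-zeroʳ (0ℤ - + suc k) ⟨
  (0ℤ - + suc k) * 0ℤ               ≡⟨ cong ((0ℤ - + suc k) *_) (c-zero {0} {suc k} (s≤s z≤n)) ⟨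
  (0ℤ - + suc k) * c 0 (suc k)      ∎
c-lower (suc n) zero = begin
  1ℤ * c (suc n) 1     ≡⟨ cong (λ t → 1ℤ * + t) (nC1≡n (suc n)) ⟩
  1ℤ * + suc n         ≡⟨ solve 1 (λ x → con 1ℤ :* x := (x :- con 0ℤ) :* con 1ℤ) refl (+ suc n) ⟩
  (+ suc n - 0ℤ) * 1ℤ  ∎
c-lower (suc n) (suc k) = begin
  + suc (suc k) * c (suc n) (suc (suc k))
    ≡⟨ cong (+ suc (suc k) *_) (c-pascal n (suc k)) ⟩
  + suc (suc k) * (y + c n (suc (suc k)))
    ≡⟨ *-distribˡ-+ (+ suc (suc k)) y (c n (suc (suc k))) ⟩
  + suc (suc k) * y + + suc (suc k) * c n (suc (suc k))
    ≡⟨ cong (λ t → + suc (suc k) * y + t) (c-lower n (suc k)) ⟩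
  + suc (suc k) * y + (+ n - + suc k) * y
    ≡⟨ solve 3 (λ n k y → (con (+ 2) :+ k) :* y :+ (n :- (con 1ℤ :+ k)) :* y
                := (con 1ℤ :+ k) :* y :+ (n :- k) :* y) refl (+ n) (+ k) y ⟩
  + suc k * y + (+ n - + k) * y
    ≡⟨ cong (λ t → t + (+ n - + k) * y) (c-lower n k) ⟩
  (+ n - + k) * c n k + (+ n - + k) * y
    ≡⟨ solve 4 (λ n k x y → (n :- k) :* x :+ (n :- k) :* y
                := (con 1ℤ :+ n :- (con 1ℤ :+ k)) :* (x :+ y)) refl (+ n) (+ k) (c n k) y ⟩
  (+ suc n - + suc k) * (c n k + y)
    ≡⟨ cong ((+ suc n - + suc k) *_) (c-pascal n k) ⟨
  (+ suc n - + suc k) * c (suc n) (suc k) ∎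
  where
  y : ℤ
  y = c n (suc k)

c-absorb : ∀ n k → + suc k * c (suc n) (suc k) ≡ + suc n * c n k
c-absorb n k = begin
  + suc k * c (suc n) (suc k)           ≡⟨ cong (+ suc k *_) (c-pascal n k) ⟩
  + suc k * (c n k + c n (suc k))       ≡⟨ *-distribˡ-+ (+ suc k) (c n k) (c n (suc k)) ⟩
  + suc k * c n k + + suc k * c n (suc k) ≡⟨ cong (λ t → + suc k * c n k + t) (c-lower n k) ⟩
  + suc k * c n k + (+ n - + k) * c n k
    ≡⟨ solve 3 (λ n k x → (con 1ℤ :+ k) :* x :+ (n :- k) :* x := (con 1ℤ :+ n) :* x)
         refl (+ n) (+ k) (c n k) ⟩
  + suc n * c n k ∎

c-raise : ∀ n k → (+ suc n - + k) * c (suc n) k ≡ + suc n * c n k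
c-raise n k = trans (sym (c-lower (suc n) k)) (c-absorb n k)

-- Both sides count the j-subsets of (j + u)-subsets of j + m elements. The offsets avoid truncated
-- subtraction.
c-trinomial : ∀ j m u →
  c (j ℕ.+ m) (j ℕ.+ u) * c (j ℕ.+ u) j ≡ c (j ℕ.+ m) j * c m u
c-trinomial zero m u = *-comm (c m u) 1ℤ
c-trinomial (suc j) m u = *-cancelˡ-≡ (+ suc j * + suc (j ℕ.+ u)) _ _ (begin
  (J * P) * (c (suc (j ℕ.+ m)) (suc (j ℕ.+ u)) * c (suc (j ℕ.+ u)) (suc j))
    ≡⟨ solve 4 (λ j p x y → (j :* p) :* (x :* y) := (p :* x) :* (j :* y)) refl J P
         (c (suc (j ℕ.+ m)) (suc (j ℕ.+ u))) (c (suc (j ℕ.+ u)) (suc j)) ⟩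
  (P * c (suc (j ℕ.+ m)) (suc (j ℕ.+ u))) * (J * c (suc (j ℕ.+ u)) (suc j))
    ≡⟨ cong₂ _*_ (c-absorb (j ℕ.+ m) (j ℕ.+ u)) (c-absorb (j ℕ.+ u) j) ⟩
  (M * c (j ℕ.+ m) (j ℕ.+ u)) * (P * c (j ℕ.+ u) j)
    ≡⟨ solve 4 (λ m p x y → (m :* x) :* (p :* y) := (m :* p) :* (x :* y)) refl M P
         (c (j ℕ.+ m) (j ℕ.+ u)) (c (j ℕ.+ u) j) ⟩
  (M * P) * (c (j ℕ.+ m) (j ℕ.+ u) * c (j ℕ.+ u) j)
    ≡⟨ cong ((M * P) *_) (c-trinomial j m u) ⟩
  (M * P) * (c (j ℕ.+ m) j * c m u)
    ≡⟨ solve 4 (λ m p x y → (m :* p) :* (x :* y) := p :* (m :* x) :* y) refl M P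
         (c (j ℕ.+ m) j) (c m u) ⟩
  P * (M * c (j ℕ.+ m) j) * c m u
    ≡⟨ cong (λ t → P * t * c m u) (c-absorb (j ℕ.+ m) j) ⟨
  P * (J * c (suc (j ℕ.+ m)) (suc j)) * c m u
    ≡⟨ solve 4 (λ j p x y → p :* (j :* x) :* y := (j :* p) :* (x :* y)) refl J P
         (c (suc (j ℕ.+ m)) (suc j)) (c m u) ⟩
  (J * P) * (c (suc (j ℕ.+ m)) (suc j) * c m u) ∎)
  where
  J M P : ℤ
  J = + suc j
  M = + suc (j ℕ.+ m)
  P = + suc (j ℕ.+ u)

c-comm : ∀ a b → c (a ℕ.+ b) a ≡ c (b ℕ.+ a) b
c-comm a b = cong +_ (begin
  (a ℕ.+ b) C a                  ≡⟨ nCk≡nC[n∸k] (ℕₚ.m≤m+n a b) ⟩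
  (a ℕ.+ b) C ((a ℕ.+ b) ℕ.∸ a)  ≡⟨ cong₂ _C_ (ℕₚ.+-comm a b) (ℕₚ.m+n∸m≡n a b) ⟩
  (b ℕ.+ a) C b                  ∎)

-- Induction on p by Pascal's rule in the first factor. Terms with u > p vanish; leaving the bound
-- `M` free lets one range of summation serve a whole antidiagonal later.
c-vandermonde : ∀ p q j M → p ℕ.≤ M →
  ∑[ u ≤ M ] (c p (toℕ u) * c q (j ℕ.+ toℕ u)) ≡ c (p ℕ.+ q) (p ℕ.+ j)
c-vandermonde zero q j M z≤n = begin
  1ℤ * c q (j ℕ.+ 0) + ∑[ u < M ] (c 0 (suc (toℕ u)) * c q (j ℕ.+ suc (toℕ u)))
    ≡⟨ cong₂ _+_ (trans (*-identityˡ _) (cong (c q) (ℕₚ.+-identityʳ j)))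
         (trans (sum-cong-≗ {M} λ u → cong (_* c q (j ℕ.+ suc (toℕ u))) (c-zero {0} {suc (toℕ u)} (s≤s z≤n)))
                (sum-replicate-zero M)) ⟩
  c q j + 0ℤ
    ≡⟨ +-identityʳ (c q j) ⟩
  c q j ∎
c-vandermonde (suc p) q j (suc M) (s≤s p≤M) = begin
  -- `f 0` is the head term for row p as well as row p + 1, since both binomials are 1. Below it
  -- completes the second sum, which therefore runs to `suc M`.
  f 0 + ∑[ u ≤ M ] (c (suc p) (suc (toℕ u)) * h (suc (toℕ u)))
    ≡⟨ cong (λ t → f 0 + t) (sum-cong-≗ {suc M} λ u → trans
         (cong (_* h (suc (toℕ u))) (c-pascal p (toℕ u)))
         (*-distribʳ-+ (h (suc (toℕ u))) (c p (toℕ u)) (c p (suc (toℕ u))))) ⟩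
  f 0 + ∑[ u ≤ M ] (c p (toℕ u) * h (suc (toℕ u)) + c p (suc (toℕ u)) * h (suc (toℕ u)))
    ≡⟨ cong (λ t → f 0 + t) (∑-distrib-+ {suc M} (λ u → c p (toℕ u) * h (suc (toℕ u)))
         (λ u → c p (suc (toℕ u)) * h (suc (toℕ u)))) ⟩
  f 0 + (∑[ u ≤ M ] (c p (toℕ u) * h (suc (toℕ u))) + ∑[ u ≤ M ] (c p (suc (toℕ u)) * h (suc (toℕ u))))
    ≡⟨ solve 3 (λ x y z → x :+ (y :+ z) := y :+ (x :+ z)) refl (f 0)
         (∑[ u ≤ M ] (c p (toℕ u) * h (suc (toℕ u)))) (∑[ u ≤ M ] (c p (suc (toℕ u)) * h (suc (toℕ u)))) ⟩
  ∑[ u ≤ M ] (c p (toℕ u) * h (suc (toℕ u))) + ∑[ u ≤ suc M ] (c p (toℕ u) * h (toℕ u))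
    ≡⟨ cong₂ _+_
         (trans (sum-cong-≗ {suc M} λ u → cong (λ t → c p (toℕ u) * c q t) (ℕₚ.+-suc j (toℕ u)))
                (c-vandermonde p q (suc j) M p≤M))
         (c-vandermonde p q j (suc M) (ℕₚ.m≤n⇒m≤1+n p≤M)) ⟩
  c (p ℕ.+ q) (p ℕ.+ suc j) + c (p ℕ.+ q) (p ℕ.+ j)
    ≡⟨ trans (+-comm (c (p ℕ.+ q) (p ℕ.+ suc j)) (c (p ℕ.+ q) (p ℕ.+ j)))
         (cong (λ t → c (p ℕ.+ q) (p ℕ.+ j) + c (p ℕ.+ q) t) (ℕₚ.+-suc p j)) ⟩
  c (p ℕ.+ q) (p ℕ.+ j) + c (p ℕ.+ q) (suc (p ℕ.+ j))
    ≡⟨ c-pascal (p ℕ.+ q) (p ℕ.+ j) ⟨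
  c (suc p ℕ.+ q) (suc p ℕ.+ j) ∎
  where
  h f : ℕ → ℤ
  h u = c q (j ℕ.+ u)
  f u = c p u * h u

-- The extra factor j + 1, cancelled at the end, serves as (2j + 1) - j in passing from C(2j + 1, j)
-- to C(2j, j).
c-central : ∀ j → + suc j * c (suc j ℕ.+ suc j) (suc j) ≡ + 2 * (1ℤ + + 2 * + j) * c (j ℕ.+ j) j
c-central j = *-cancelˡ-≡ (+ suc j) _ _ (begin
  J * (J * c (suc j ℕ.+ suc j) (suc j))
    ≡⟨ cong (J *_) (c-absorb (j ℕ.+ suc j) j) ⟩
  J * ((1ℤ + (+ j + J)) * c (j ℕ.+ suc j) j)
    ≡⟨ cong (λ t → J * ((1ℤ + (+ j + J)) * c t j)) (ℕₚ.+-suc j j) ⟩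
  J * ((1ℤ + (+ j + J)) * c (suc (j ℕ.+ j)) j)
    ≡⟨ solve 2 (λ j x → (con 1ℤ :+ j) :* ((con 1ℤ :+ (j :+ (con 1ℤ :+ j))) :* x)
          := con (+ 2) :* (con 1ℤ :+ j) :* ((con 1ℤ :+ (j :+ j) :- j) :* x)) refl (+ j) (c (suc (j ℕ.+ j)) j) ⟩
  + 2 * J * ((+ suc (j ℕ.+ j) - + j) * c (suc (j ℕ.+ j)) j)
    ≡⟨ cong (+ 2 * J *_) (c-raise (j ℕ.+ j) j) ⟩
  + 2 * J * (+ suc (j ℕ.+ j) * c (j ℕ.+ j) j)
    ≡⟨ solve 2 (λ j x → con (+ 2) :* (con 1ℤ :+ j) :* ((con 1ℤ :+ (j :+ j)) :* x)
          := (con 1ℤ :+ j) :* (con (+ 2) :* (con 1ℤ :+ con (+ 2) :* j) :* x)) refl (+ j) (c (j ℕ.+ j) j) ⟩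
  J * (+ 2 * (1ℤ + + 2 * + j) * c (j ℕ.+ j) j) ∎)
  where
  J : ℤ
  J = + suc j

-- With a = j + p and N = a + b, both sides are the multinomial coefficient N! / (j! a! (b - j)!),
-- or zero when b < j. The two uses of `c-trinomial` meet at C(N, 2j + p) C(2j + p, j).
C*V≡ : ∀ j p b →
  c (j ℕ.+ p ℕ.+ b) j * c (p ℕ.+ b) (p ℕ.+ j) ≡ c (j ℕ.+ p ℕ.+ b) (j ℕ.+ p) * c b j
C*V≡ j p b = begin
  c (j ℕ.+ p ℕ.+ b) j * c (p ℕ.+ b) (p ℕ.+ j)
    ≡⟨ cong₂ (λ s t → c s j * c (p ℕ.+ b) t) (ℕₚ.+-assoc j p b) (ℕₚ.+-comm p j) ⟩
  c (j ℕ.+ (p ℕ.+ b)) j * c (p ℕ.+ b) (j ℕ.+ p)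
    ≡⟨ c-trinomial j (p ℕ.+ b) (j ℕ.+ p) ⟨
  c (j ℕ.+ (p ℕ.+ b)) (j ℕ.+ (j ℕ.+ p)) * c (j ℕ.+ (j ℕ.+ p)) j
    ≡⟨ cong₂ _*_ (cong₂ c (sym (ℕₚ.+-assoc j p b)) (ℕₚ.+-comm j (j ℕ.+ p))) (c-comm j (j ℕ.+ p)) ⟩
  c (j ℕ.+ p ℕ.+ b) (j ℕ.+ p ℕ.+ j) * c (j ℕ.+ p ℕ.+ j) (j ℕ.+ p)
    ≡⟨ c-trinomial (j ℕ.+ p) b j ⟩
  c (j ℕ.+ p ℕ.+ b) (j ℕ.+ p) * c b j ∎

-- For p = a - j, `C*V≡` turns C(a + b, a) C(b, j) into C(a + b, j) C(p + b, p + j); Vandermonde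
-- expands the last factor and `c-trinomial` absorbs C(a, j). The coefficients C(a + b, j) C(j + u,
-- j) are constant on an antidiagonal, so they can leave the weighted sum.
C*V-expansion : ∀ a b j M → a ℕ.≤ M →
  c (a ℕ.+ b) a * (c a j * c b j) ≡
  ∑[ u ≤ M ] (c (a ℕ.+ b) j * c (j ℕ.+ toℕ u) j * (c a (j ℕ.+ toℕ u) * c b (j ℕ.+ toℕ u)))
C*V-expansion a b j M a≤M with j ℕₚ.≤? a
... | no j≰a = begin
  c (a ℕ.+ b) a * (c a j * c b j)
    ≡⟨ cong (λ t → c (a ℕ.+ b) a * (t * c b j)) (c-zero a<j) ⟩
  c (a ℕ.+ b) a * (0ℤ * c b j)
    ≡⟨ *-zeroʳ (c (a ℕ.+ b) a) ⟩
  0ℤ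
    ≡⟨ sum-replicate-zero (suc M) ⟨
  ∑[ u ≤ M ] 0ℤ
    ≡⟨ sum-cong-≗ {suc M} (λ u → begin
         0ℤ
           ≡⟨ *-zeroʳ (c (a ℕ.+ b) j * c (j ℕ.+ toℕ u) j) ⟨
         c (a ℕ.+ b) j * c (j ℕ.+ toℕ u) j * (0ℤ * c b (j ℕ.+ toℕ u))
           ≡⟨ cong (λ t → c (a ℕ.+ b) j * c (j ℕ.+ toℕ u) j * (t * c b (j ℕ.+ toℕ u)))
                (c-zero (ℕₚ.≤-trans a<j (ℕₚ.m≤m+n j (toℕ u)))) ⟨
         c (a ℕ.+ b) j * c (j ℕ.+ toℕ u) j * (c a (j ℕ.+ toℕ u) * c b (j ℕ.+ toℕ u)) ∎) ⟩
  ∑[ u ≤ M ] (c (a ℕ.+ b) j * c (j ℕ.+ toℕ u) j * (c a (j ℕ.+ toℕ u) * c b (j ℕ.+ toℕ u))) ∎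
  where
  a<j : a ℕ.< j
  a<j = ℕₚ.≰⇒> j≰a
... | yes j≤a with ℕₚ.m≤n⇒∃[o]m+o≡n j≤a
... | p , refl = sym (begin
  ∑[ u ≤ M ] (N * c (j ℕ.+ toℕ u) j * (c a (j ℕ.+ toℕ u) * c b (j ℕ.+ toℕ u)))
    ≡⟨ sum-cong-≗ {suc M} (λ u → begin
         N * c (j ℕ.+ toℕ u) j * (c a (j ℕ.+ toℕ u) * c b (j ℕ.+ toℕ u))
           ≡⟨ solve 4 (λ n x y z → n :* x :* (y :* z) := n :* (y :* x) :* z) refl
                N (c (j ℕ.+ toℕ u) j) (c a (j ℕ.+ toℕ u)) (c b (j ℕ.+ toℕ u)) ⟩
         N * (c a (j ℕ.+ toℕ u) * c (j ℕ.+ toℕ u) j) * c b (j ℕ.+ toℕ u)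
           ≡⟨ cong (λ t → N * t * c b (j ℕ.+ toℕ u)) (c-trinomial j p (toℕ u)) ⟩
         N * (c a j * c p (toℕ u)) * c b (j ℕ.+ toℕ u)
           ≡⟨ solve 4 (λ n x y z → n :* (x :* y) :* z := n :* x :* (y :* z)) refl
                N (c a j) (c p (toℕ u)) (c b (j ℕ.+ toℕ u)) ⟩
         N * c a j * (c p (toℕ u) * c b (j ℕ.+ toℕ u)) ∎) ⟩
  ∑[ u ≤ M ] (N * c a j * (c p (toℕ u) * c b (j ℕ.+ toℕ u)))
    ≡⟨ *-distribˡ-sum {suc M} (N * c a j) (λ u → c p (toℕ u) * c b (j ℕ.+ toℕ u)) ⟨
  N * c a j * ∑[ u ≤ M ] (c p (toℕ u) * c b (j ℕ.+ toℕ u))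
    ≡⟨ cong (N * c a j *_) (c-vandermonde p b j M (ℕₚ.m+n≤o⇒n≤o j a≤M)) ⟩
  N * c a j * c (p ℕ.+ b) (p ℕ.+ j)
    ≡⟨ solve 3 (λ n x y → n :* x :* y := n :* y :* x) refl N (c a j) (c (p ℕ.+ b) (p ℕ.+ j)) ⟩
  N * c (p ℕ.+ b) (p ℕ.+ j) * c a j
    ≡⟨ cong (_* c a j) (C*V≡ j p b) ⟩
  c (a ℕ.+ b) a * c b j * c a j
    ≡⟨ solve 3 (λ n x y → n :* x :* y := n :* (y :* x)) refl (c (a ℕ.+ b) a) (c b j) (c a j) ⟩
  c (a ℕ.+ b) a * (c a j * c b j) ∎)
  where
  N : ℤ
  N = c (a ℕ.+ b) j

-- Sums over the antidiagonal a + b = N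

-- Summands take both coordinates, so pointwise arguments can match on a + b = N and never meet
-- truncated subtraction.
antidiagonal : ℕ → (ℕ → ℕ → ℤ) → ℤ
antidiagonal N f = ∑[ k ≤ N ] f (toℕ k) (N ℕ.∸ toℕ k)

antidiagonal-cong : ∀ N {f g : ℕ → ℕ → ℤ} → (∀ a b → a ℕ.+ b ≡ N → f a b ≡ g a b) →
  antidiagonal N f ≡ antidiagonal N g
antidiagonal-cong N f≡g =
  sum-cong-≗ {suc N} λ k → f≡g (toℕ k) (N ℕ.∸ toℕ k) (ℕₚ.m+[n∸m]≡n (toℕ≤pred[n] k))

antidiagonal-zero : ∀ N {f : ℕ → ℕ → ℤ} → (∀ a b → a ℕ.+ b ≡ N → f a b ≡ 0ℤ) →
  antidiagonal N f ≡ 0ℤ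
antidiagonal-zero N f≡0 = trans (antidiagonal-cong N {g = λ _ _ → 0ℤ} f≡0) (sum-replicate-zero (suc N))

antidiagonal-linear : ∀ N α β (f g : ℕ → ℕ → ℤ) →
  antidiagonal N (λ a b → α * f a b + β * g a b) ≡ α * antidiagonal N f + β * antidiagonal N g
antidiagonal-linear N α β f g = trans
  (∑-distrib-+ {suc N} (λ k → α * f (toℕ k) (N ℕ.∸ toℕ k)) (λ k → β * g (toℕ k) (N ℕ.∸ toℕ k)))
  (sym (cong₂ _+_ (*-distribˡ-sum {suc N} α (λ k → f (toℕ k) (N ℕ.∸ toℕ k)))
                  (*-distribˡ-sum {suc N} β (λ k → g (toℕ k) (N ℕ.∸ toℕ k)))))

-- Each `X` cancels the `Y` of the next point, so only the two ends survive. Splitting the summand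
-- into two functions avoids predecessors.
antidiagonal-telescope : (X Y : ℕ → ℕ → ℤ) → (∀ a b → X a (suc b) + Y (suc a) b ≡ 0ℤ) →
  ∀ N → antidiagonal N (λ a b → X a b + Y a b) ≡ Y 0 N + X N 0
antidiagonal-telescope X Y X+Y≡0 zero = solve 2 (λ x y → x :+ y :+ con 0ℤ := y :+ x) refl (X 0 0) (Y 0 0)
antidiagonal-telescope X Y X+Y≡0 (suc N) = begin
  X 0 (suc N) + Y 0 (suc N) + antidiagonal N (λ a b → X (suc a) b + Y (suc a) b)
    ≡⟨ cong (λ t → X 0 (suc N) + Y 0 (suc N) + t)
         (antidiagonal-telescope (λ a b → X (suc a) b) (λ a b → Y (suc a) b) (λ a b → X+Y≡0 (suc a) b) N) ⟩
  X 0 (suc N) + Y 0 (suc N) + (Y 1 N + X (suc N) 0)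
    ≡⟨ solve 4 (λ x y z w → x :+ y :+ (z :+ w) := (x :+ z) :+ (y :+ w)) refl
         (X 0 (suc N)) (Y 0 (suc N)) (Y 1 N) (X (suc N) 0) ⟩
  (X 0 (suc N) + Y 1 N) + (Y 0 (suc N) + X (suc N) 0)
    ≡⟨ cong (_+ (Y 0 (suc N) + X (suc N) 0)) (X+Y≡0 0 N) ⟩
  0ℤ + (Y 0 (suc N) + X (suc N) 0)
    ≡⟨ +-identityˡ _ ⟩
  Y 0 (suc N) + X (suc N) 0 ∎

-- Together with `antidiagonal-head`, this isolates the central term of a sum that vanishes on both
-- sides of it.
antidiagonal-drop : ∀ j N (f : ℕ → ℕ → ℤ) → (∀ a b → a ℕ.< j → f a b ≡ 0ℤ) →
  antidiagonal (j ℕ.+ N) f ≡ antidiagonal N (λ a b → f (j ℕ.+ a) b)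
antidiagonal-drop zero N f f≡0 = refl
antidiagonal-drop (suc j) N f f≡0 = trans
  (cong₂ _+_ (f≡0 0 (suc j ℕ.+ N) (s≤s z≤n))
    (antidiagonal-drop j N (λ a b → f (suc a) b) (λ a b a<j → f≡0 (suc a) b (s≤s a<j))))
  (+-identityˡ _)

antidiagonal-head : ∀ N (f : ℕ → ℕ → ℤ) → (∀ a b → suc a ℕ.+ b ≡ N → f (suc a) b ≡ 0ℤ) →
  antidiagonal N f ≡ f 0 N
antidiagonal-head zero f f≡0 = +-identityʳ (f 0 0)
antidiagonal-head (suc N) f f≡0 = trans
  (cong (λ t → f 0 (suc N) + t) (antidiagonal-zero N λ a b a+b≡N → f≡0 a b (cong suc a+b≡N)))
  (+-identityʳ (f 0 (suc N)))

∣-sum : ∀ {d} n (f : Fin n → ℤ) → (∀ i → d ∣ f i) → d ∣ sum f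
∣-sum zero f d∣f = divides 0ℤ refl
∣-sum (suc n) f d∣f =
  ∣m∣n⇒∣m+n (d∣f Fin.zero) (∣-sum n (λ i → f (Fin.suc i)) (λ i → d∣f (Fin.suc i)))

-- Super Catalan numbers

S-sym : ∀ a b → S a b ≡ S b a
S-sym a b = ℕₚ.*-cancelʳ-≡ _ _ (superDen a b) {{superDen≢0 a b}} (begin
  S a b ℕ.* superDen a b  ≡⟨ S*superDen≡superNum a b ⟩
  superNum a b            ≡⟨ ℕₚ.*-comm ((2 ℕ.* a) !) _ ⟩
  superNum b a            ≡⟨ S*superDen≡superNum b a ⟨
  S b a ℕ.* superDen b a
    ≡⟨ cong (S b a ℕ.*_) (cong₂ ℕ._*_ (ℕₚ.*-comm (b !) (a !)) (cong _! (ℕₚ.+-comm b a))) ⟩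
  S b a ℕ.* superDen a b  ∎)

-- The ratio (2a + 2)! / (2a)! = 2 (a + 1)(2a + 1) yields that of S(a + 1, b) to S(a, b). This ratio
-- and `S-sym` are all that the sequel uses about super Catalan numbers.
S-sucˡ-ℕ : ∀ a b → suc (a ℕ.+ b) ℕ.* S (suc a) b ≡ 2 ℕ.* (1 ℕ.+ 2 ℕ.* a) ℕ.* S a b
S-sucˡ-ℕ a b = ℕₚ.*-cancelʳ-≡ _ _ (suc a ℕ.* superDen a b) (begin
  suc (a ℕ.+ b) ℕ.* r ℕ.* (suc a ℕ.* superDen a b)
    ≡⟨ ℕs.solve 6 (λ r s a x y z → s ℕs.:* r ℕs.:* (a ℕs.:* (x ℕs.:* y ℕs.:* z))
                ℕs.:= r ℕs.:* (a ℕs.:* x ℕs.:* y ℕs.:* (s ℕs.:* z)))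
         refl r (suc (a ℕ.+ b)) (suc a) (a !) (b !) ((a ℕ.+ b) !) ⟩
  r ℕ.* superDen (suc a) b
    ≡⟨ S*superDen≡superNum (suc a) b ⟩
  superNum (suc a) b
    ≡⟨ cong (λ t → t ! ℕ.* (2 ℕ.* b) !) (ℕₚ.*-suc 2 a) ⟩
  (2 ℕ.+ 2 ℕ.* a) ℕ.* ((1 ℕ.+ 2 ℕ.* a) ℕ.* (2 ℕ.* a) !) ℕ.* (2 ℕ.* b) !
    ≡⟨ ℕs.solve 3 (λ a x y → (ℕs.con 2 ℕs.:+ ℕs.con 2 ℕs.:* a) ℕs.:* ((ℕs.con 1 ℕs.:+ ℕs.con 2 ℕs.:* a) ℕs.:* x) ℕs.:* y
                ℕs.:= ℕs.con 2 ℕs.:* (ℕs.con 1 ℕs.:+ ℕs.con 2 ℕs.:* a) ℕs.:* (ℕs.con 1 ℕs.:+ a) ℕs.:* (x ℕs.:* y))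
         refl a ((2 ℕ.* a) !) ((2 ℕ.* b) !) ⟩
  2 ℕ.* (1 ℕ.+ 2 ℕ.* a) ℕ.* suc a ℕ.* superNum a b
    ≡⟨ cong (2 ℕ.* (1 ℕ.+ 2 ℕ.* a) ℕ.* suc a ℕ.*_) (S*superDen≡superNum a b) ⟨
  2 ℕ.* (1 ℕ.+ 2 ℕ.* a) ℕ.* suc a ℕ.* (S a b ℕ.* superDen a b)
    ≡⟨ ℕs.solve 4 (λ c a q d → c ℕs.:* a ℕs.:* (q ℕs.:* d) ℕs.:= c ℕs.:* q ℕs.:* (a ℕs.:* d))
         refl (2 ℕ.* (1 ℕ.+ 2 ℕ.* a)) (suc a) (S a b) (superDen a b) ⟩
  2 ℕ.* (1 ℕ.+ 2 ℕ.* a) ℕ.* S a b ℕ.* (suc a ℕ.* superDen a b) ∎)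
  where
  module ℕs = ℕ.+-*-Solver
  r : ℕ
  r = S (suc a) b
  instance
    _ = ℕₚ.m*n≢0 (suc a) (superDen a b) {{_}} {{superDen≢0 a b}}

s : ℕ → ℕ → ℤ
s a b = + S a b

s-sucˡ : ∀ a b → + suc (a ℕ.+ b) * s (suc a) b ≡ + 2 * (1ℤ + + 2 * + a) * s a b
s-sucˡ a b = begin
  + suc (a ℕ.+ b) * s (suc a) b
    ≡⟨ pos-* (suc (a ℕ.+ b)) (S (suc a) b) ⟨
  + (suc (a ℕ.+ b) ℕ.* S (suc a) b)
    ≡⟨ cong +_ (S-sucˡ-ℕ a b) ⟩
  + (2 ℕ.* (1 ℕ.+ 2 ℕ.* a) ℕ.* S a b)
    ≡⟨ pos-* (2 ℕ.* (1 ℕ.+ 2 ℕ.* a)) (S a b) ⟩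
  + (2 ℕ.* (1 ℕ.+ 2 ℕ.* a)) * s a b
    ≡⟨ cong (_* s a b) (pos-* 2 (1 ℕ.+ 2 ℕ.* a)) ⟩
  + 2 * (1ℤ + + (2 ℕ.* a)) * s a b
    ≡⟨ cong (λ t → + 2 * (1ℤ + t) * s a b) (pos-* 2 a) ⟩
  + 2 * (1ℤ + + 2 * + a) * s a b ∎

-- The alternating sums of the U j

U : ℕ → ℕ → ℕ → ℤ
U j a b = c (a ℕ.+ b) a * (c a j * c b j)

U-suc : ∀ j a b → + suc j * + suc j * U (suc j) a b ≡ (+ a - + j) * (+ b - + j) * U j a b
U-suc j a b = begin
  J * J * (K * (c a (suc j) * c b (suc j)))
    ≡⟨ solve 4 (λ j c x y → j :* j :* (c :* (x :* y)) := c :* ((j :* x) :* (j :* y))) refl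
         J K (c a (suc j)) (c b (suc j)) ⟩
  K * ((J * c a (suc j)) * (J * c b (suc j)))
    ≡⟨ cong₂ (λ x y → K * (x * y)) (c-lower a j) (c-lower b j) ⟩
  K * (((+ a - + j) * c a j) * ((+ b - + j) * c b j))
    ≡⟨ solve 5 (λ c p x q y → c :* ((p :* x) :* (q :* y)) := p :* q :* (c :* (x :* y))) refl
         K (+ a - + j) (c a j) (+ b - + j) (c b j) ⟩
  (+ a - + j) * (+ b - + j) * U j a b ∎
  where
  J K : ℤ
  J = + suc j
  K = c (a ℕ.+ b) a

-- An end of the telescoping sum. The linear factor vanishes for j = 0 and C(0, j) for j > 0;
-- `c-lower` in row 0 treats both cases at once.
U-zeroˡ : ∀ j b → (0ℤ - + j) * U j 0 b ≡ 0ℤ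
U-zeroˡ j b = begin
  (0ℤ - + j) * (K * (c 0 j * c b j))
    ≡⟨ solve 4 (λ p c x y → p :* (c :* (x :* y)) := p :* x :* (c :* y)) refl (0ℤ - + j) K (c 0 j) (c b j) ⟩
  (0ℤ - + j) * c 0 j * (K * c b j)
    ≡⟨ cong (_* (K * c b j)) (c-lower 0 j) ⟨
  + suc j * 0ℤ * (K * c b j)
    ≡⟨ cong (_* (K * c b j)) (*-zeroʳ (+ suc j)) ⟩
  0ℤ ∎
  where
  K : ℤ
  K = c b 0

U-zeroʳ : ∀ j a → (0ℤ - + j) * U j a 0 ≡ 0ℤ
U-zeroʳ j a = begin
  (0ℤ - + j) * (K * (c a j * c 0 j))
    ≡⟨ solve 4 (λ p c x y → p :* (c :* (x :* y)) := p :* y :* (c :* x)) refl (0ℤ - + j) K (c a j) (c 0 j) ⟩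
  (0ℤ - + j) * c 0 j * (K * c a j)
    ≡⟨ cong (_* (K * c a j)) (c-lower 0 j) ⟨
  + suc j * 0ℤ * (K * c a j)
    ≡⟨ cong (_* (K * c a j)) (*-zeroʳ (+ suc j)) ⟩
  0ℤ ∎
  where
  K : ℤ
  K = c (a ℕ.+ 0) a

-- By `c-raise` the linear factors become b + 1 and a + 1, which balance the neighbouring binomials
-- C(a + b + 1, a) and C(a + b + 1, a + 1).
U-shift : ∀ j a b → (+ suc b - + j) * U j a (suc b) ≡ (+ suc a - + j) * U j (suc a) b
U-shift j a b = begin
  (+ suc b - + j) * (K * (c a j * c (suc b) j))
    ≡⟨ solve 4 (λ p c x y → p :* (c :* (x :* y)) := c :* (x :* (p :* y))) refl
         (+ suc b - + j) K (c a j) (c (suc b) j) ⟩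
  K * (c a j * ((+ suc b - + j) * c (suc b) j))
    ≡⟨ cong (λ t → K * (c a j * t)) (c-raise b j) ⟩
  K * (c a j * (+ suc b * c b j))
    ≡⟨ solve 4 (λ p c x y → c :* (x :* (p :* y)) := (p :* c) :* (x :* y)) refl
         (+ suc b) K (c a j) (c b j) ⟩
  (+ suc b * K) * (c a j * c b j)
    ≡⟨ cong (_* (c a j * c b j)) K-shift ⟩
  (+ suc a * K′) * (c a j * c b j)
    ≡⟨ solve 4 (λ p c x y → (p :* c) :* (x :* y) := c :* ((p :* x) :* y)) refl
         (+ suc a) K′ (c a j) (c b j) ⟩
  K′ * ((+ suc a * c a j) * c b j)
    ≡⟨ cong (λ t → K′ * (t * c b j)) (c-raise a j) ⟨
  K′ * (((+ suc a - + j) * c (suc a) j) * c b j)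
    ≡⟨ solve 4 (λ p c x y → c :* ((p :* x) :* y) := p :* (c :* (x :* y))) refl
         (+ suc a - + j) K′ (c (suc a) j) (c b j) ⟩
  (+ suc a - + j) * U j (suc a) b ∎
  where
  K K′ : ℤ
  K = c (a ℕ.+ suc b) a
  K′ = c (suc a ℕ.+ b) (suc a)
  K-shift : + suc b * K ≡ + suc a * K′
  K-shift = begin
    + suc b * K
      ≡⟨ cong (_* K) (solve 2 (λ a b → con 1ℤ :+ b := a :+ (con 1ℤ :+ b) :- a) refl (+ a) (+ b)) ⟩
    (+ (a ℕ.+ suc b) - + a) * K
      ≡⟨ c-lower (a ℕ.+ suc b) a ⟨
    + suc a * c (a ℕ.+ suc b) (suc a)
      ≡⟨ cong (λ t → + suc a * c t (suc a)) (ℕₚ.+-suc a b) ⟩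
    + suc a * K′ ∎

U-<ˡ : ∀ {j a} b → a ℕ.< j → U j a b ≡ 0ℤ
U-<ˡ {j} {a} b a<j = trans (cong (λ t → c (a ℕ.+ b) a * (t * c b j)) (c-zero a<j)) (*-zeroʳ (c (a ℕ.+ b) a))

U-<ʳ : ∀ {j b} a → b ℕ.< j → U j a b ≡ 0ℤ
U-<ʳ {j} {b} a b<j = begin
  c (a ℕ.+ b) a * (c a j * c b j) ≡⟨ cong (λ t → c (a ℕ.+ b) a * (c a j * t)) (c-zero b<j) ⟩
  c (a ℕ.+ b) a * (c a j * 0ℤ)    ≡⟨ cong (c (a ℕ.+ b) a *_) (*-zeroʳ (c a j)) ⟩
  c (a ℕ.+ b) a * 0ℤ              ≡⟨ *-zeroʳ (c (a ℕ.+ b) a) ⟩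
  0ℤ                              ∎

-- Alternating super Catalan weights

module _ (l : ℕ) where

  w : ℕ → ℕ → ℤ
  w a b = -1ℤ ^ a * (s a l * s b l)

  -- By `s-sucˡ` both products reduce, up to sign, to 2 (2a + 1)(2b + 1) S(a, l) S(b, l), and the
  -- sign alternates. With `U-shift` this makes the certificate telescope.
  w-shift : ∀ a b →
    (+ suc b + + l) * (1ℤ + + 2 * + a) * w a (suc b) + (+ suc a + + l) * (1ℤ + + 2 * + b) * w (suc a) b ≡ 0ℤ
  w-shift a b = begin
    (+ suc b + + l) * A * (σ * (s a l * s (suc b) l)) + (+ suc a + + l) * B * (-1ℤ * σ * (s (suc a) l * s b l))
      ≡⟨ solve 9 (λ p a′ q b′ σ x x′ y y′ →
             p :* a′ :* (σ :* (x :* y′)) :+ q :* b′ :* (con -1ℤ :* σ :* (x′ :* y))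
             := σ :* (a′ :* x :* (p :* y′) :- b′ :* y :* (q :* x′)))
           refl (+ suc b + + l) A (+ suc a + + l) B σ (s a l) (s (suc a) l) (s b l) (s (suc b) l) ⟩
    σ * (A * s a l * ((+ suc b + + l) * s (suc b) l) - B * s b l * ((+ suc a + + l) * s (suc a) l))
      ≡⟨ cong₂ (λ x y → σ * (A * s a l * x - B * s b l * y)) (s-sucˡ b l) (s-sucˡ a l) ⟩
    σ * (A * s a l * (+ 2 * B * s b l) - B * s b l * (+ 2 * A * s a l))
      ≡⟨ solve 5 (λ σ a′ b′ x y →
             σ :* (a′ :* x :* (con (+ 2) :* b′ :* y) :- b′ :* y :* (con (+ 2) :* a′ :* x)) := con 0ℤ)
           refl σ A B (s a l) (s b l) ⟩
    0ℤ ∎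
    where
    σ A B : ℤ
    σ = -1ℤ ^ a
    A = 1ℤ + + 2 * + a
    B = 1ℤ + + 2 * + b

  weightedSum : ℕ → (ℕ → ℕ → ℤ) → ℤ
  weightedSum N f = antidiagonal N (λ a b → f a b * w a b)

  -- The recurrence in j that Zeilberger's algorithm finds; its certificate is Y below.
  α β : ℕ → ℕ → ℤ
  α N j = + 2 * (+ N + + 2 * + l - + 2 * + j - 1ℤ) * (+ suc j * + suc j)
  β N j = (+ N + + l - + j) * (1ℤ + + 2 * + j) * (+ N - + 2 * + j)

  -- The summand equals `X` + `Y`, where the polynomial factors of `X` are those of `Y` with a and b
  -- exchanged. `U-shift` and `w-shift` cancel each `X` against the next `Y`; the ends vanish by
  -- `U-zeroˡ` and `U-zeroʳ`.
  weightedSum-U-rec : ∀ N j → α N j * weightedSum N (U (suc j)) + β N j * weightedSum N (U j) ≡ 0ℤ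
  weightedSum-U-rec N j = begin
    α N j * weightedSum N (U (suc j)) + β N j * weightedSum N (U j)
      ≡⟨ antidiagonal-linear N (α N j) (β N j) (λ a b → U (suc j) a b * w a b) (λ a b → U j a b * w a b) ⟨
    antidiagonal N (λ a b → α N j * (U (suc j) a b * w a b) + β N j * (U j a b * w a b))
      ≡⟨ antidiagonal-cong N pointwise ⟩
    antidiagonal N (λ a b → X a b + Y a b)
      ≡⟨ antidiagonal-telescope X Y X+Y≡0 N ⟩
    Y 0 N + X N 0
      ≡⟨ cong₂ _+_ (cong (_* ((0ℤ + + l) * (1ℤ + + 2 * + N) * w 0 N)) (U-zeroˡ j N))
                   (cong (_* ((0ℤ + + l) * (1ℤ + + 2 * + N) * w N 0)) (U-zeroʳ j N)) ⟩
    0ℤ ∎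
    where
    X Y : ℕ → ℕ → ℤ
    X a b = (+ b - + j) * U j a b * ((+ b + + l) * (1ℤ + + 2 * + a) * w a b)
    Y a b = (+ a - + j) * U j a b * ((+ a + + l) * (1ℤ + + 2 * + b) * w a b)

    X+Y≡0 : ∀ a b → X a (suc b) + Y (suc a) b ≡ 0ℤ
    X+Y≡0 a b = begin
      (+ suc b - + j) * U j a (suc b) * x + u * y
        ≡⟨ cong (λ t → t * x + u * y) (U-shift j a b) ⟩
      u * x + u * y
        ≡⟨ *-distribˡ-+ u x y ⟨
      u * (x + y)
        ≡⟨ cong (u *_) (w-shift a b) ⟩
      u * 0ℤ
        ≡⟨ *-zeroʳ u ⟩
      0ℤ ∎
      where
      u x y : ℤ
      u = (+ suc a - + j) * U j (suc a) b
      x = (+ suc b + + l) * (1ℤ + + 2 * + a) * w a (suc b)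
      y = (+ suc a + + l) * (1ℤ + + 2 * + b) * w (suc a) b

    pointwise : ∀ a b → a ℕ.+ b ≡ N →
      α N j * (U (suc j) a b * w a b) + β N j * (U j a b * w a b) ≡ X a b + Y a b
    pointwise a b refl = begin
      + 2 * k * (+ suc j * + suc j) * (U (suc j) a b * w a b) + β N j * (U j a b * w a b)
        ≡⟨ solve 6 (λ k j u v β w → con (+ 2) :* k :* (j :* j) :* (v :* w) :+ β :* (u :* w)
              := con (+ 2) :* k :* (j :* j :* v) :* w :+ β :* (u :* w))
             refl k (+ suc j) (U j a b) (U (suc j) a b) (β N j) (w a b) ⟩
      + 2 * k * (+ suc j * + suc j * U (suc j) a b) * w a b + β N j * (U j a b * w a b)
        ≡⟨ cong (λ t → + 2 * k * t * w a b + β N j * (U j a b * w a b)) (U-suc j a b) ⟩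
      + 2 * k * ((+ a - + j) * (+ b - + j) * U j a b) * w a b + β N j * (U j a b * w a b)
        -- After `U-suc` both terms share the factor `U j a b * w a b`, and a polynomial identity in
        -- a, b, l, j remains.
        ≡⟨ solve 6 (λ a b l j u w →
              con (+ 2) :* (a :+ b :+ con (+ 2) :* l :- con (+ 2) :* j :- con 1ℤ)
                :* ((a :- j) :* (b :- j) :* u) :* w
              :+ (a :+ b :+ l :- j) :* (con 1ℤ :+ con (+ 2) :* j) :* (a :+ b :- con (+ 2) :* j) :* (u :* w)
              := (b :- j) :* u :* ((b :+ l) :* (con 1ℤ :+ con (+ 2) :* a) :* w)
              :+ (a :- j) :* u :* ((a :+ l) :* (con 1ℤ :+ con (+ 2) :* b) :* w))
             refl (+ a) (+ b) (+ l) (+ j) (U j a b) (w a b) ⟩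
      X a b + Y a b ∎
      where
      k : ℤ
      k = + N + + 2 * + l - + 2 * + j - 1ℤ

  -- The last argument is n − j, so that l + N stands for n + l − j.
  closedForm : ℕ → ℕ → ℕ → ℤ
  closedForm n j N = -1ℤ ^ j * (s n l * s (l ℕ.+ N) n) * (c n j * c (j ℕ.+ j) j)

  weightedSum-U-diagonal : ∀ j → weightedSum (j ℕ.+ j) (U j) ≡ closedForm j j 0
  weightedSum-U-diagonal j = begin
    antidiagonal (j ℕ.+ j) f
      -- Points with a < j vanish through C(a, j); beyond a = j, the constraint a + b = 2j forces b
      -- < j.
      ≡⟨ antidiagonal-drop j j f (λ a b a<j → cong (_* w a b) (U-<ˡ b a<j)) ⟩
    antidiagonal j (λ a b → f (j ℕ.+ a) b)
      ≡⟨ antidiagonal-head j (λ a b → f (j ℕ.+ a) b) (λ a b eq → cong (_* w (j ℕ.+ suc a) b)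
           (U-<ʳ (j ℕ.+ suc a) (ℕₚ.≤-trans (s≤s (ℕₚ.m≤n+m b a)) (ℕₚ.≤-reflexive eq)))) ⟩
    f (j ℕ.+ 0) j
      ≡⟨ cong (λ t → f t j) (ℕₚ.+-identityʳ j) ⟩
    c (j ℕ.+ j) j * (c j j * c j j) * (-1ℤ ^ j * (s j l * s j l))
      -- One C(j, j) becomes 1, the other stays as the factor C(n, j) of the closed form at n = j.
      -- Likewise one S(j, l) stays and the other turns into S(l + 0, j).
      ≡⟨ cong₂ (λ x y → c (j ℕ.+ j) j * (+ x * c j j) * (-1ℤ ^ j * (s j l * + y))) (nCn≡1 j)
           (trans (S-sym j l) (cong (λ t → S t j) (sym (ℕₚ.+-identityʳ l)))) ⟩
    c (j ℕ.+ j) j * (1ℤ * c j j) * (-1ℤ ^ j * (s j l * s (l ℕ.+ 0) j))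
      ≡⟨ solve 4 (λ x y σ z → x :* (con 1ℤ :* y) :* (σ :* z) := σ :* z :* (y :* x)) refl
           (c (j ℕ.+ j) j) (c j j) (-1ℤ ^ j) (s j l * s (l ℕ.+ 0) j) ⟩
    closedForm j j 0 ∎
    where
    f : ℕ → ℕ → ℤ
    f a b = U j a b * w a b

  module _ (j N : ℕ) where
    private
      n : ℕ
      n = j ℕ.+ suc N

    closedForm-rec : α (n ℕ.+ n) j * closedForm n (suc j) N + β (n ℕ.+ n) j * closedForm n j (suc N) ≡ 0ℤ
    closedForm-rec = begin
      α (n ℕ.+ n) j * closedForm n (suc j) N + β (n ℕ.+ n) j * closedForm n j (suc N)
        -- Since n - j = N + 1, the coefficients are 2 (2(l + N) + 1)(j + 1)² and 2 (l + N + n +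
        -- 1)(2j + 1)(N + 1): just the factors consumed by `s-sucˡ`, `c-lower` and `c-central`.
        ≡⟨ solve 11 (λ j N l σ sn p q x₀ x₁ y₀ y₁ →
              let n = j :+ (con 1ℤ :+ N) in
              con (+ 2) :* (n :+ n :+ con (+ 2) :* l :- con (+ 2) :* j :- con 1ℤ) :* ((con 1ℤ :+ j) :* (con 1ℤ :+ j))
                :* (con -1ℤ :* σ :* (sn :* p) :* (x₁ :* y₁))
              :+ (n :+ n :+ l :- j) :* (con 1ℤ :+ con (+ 2) :* j) :* (n :+ n :- con (+ 2) :* j)
                :* (σ :* (sn :* q) :* (x₀ :* y₀))
              := con (+ 2) :* σ :* sn :*
                 ((con 1ℤ :+ con (+ 2) :* j) :* (con 1ℤ :+ N) :* x₀ :* y₀ :* ((con 1ℤ :+ (l :+ N :+ n)) :* q)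
                 :- (con 1ℤ :+ con (+ 2) :* (l :+ N)) :* p :* (((con 1ℤ :+ j) :* x₁) :* ((con 1ℤ :+ j) :* y₁))))
             refl (+ j) (+ N) (+ l) (-1ℤ ^ j) (s n l) p (s (l ℕ.+ suc N) n)
             x₀ (c n (suc j)) y₀ (c (suc j ℕ.+ suc j) (suc j)) ⟩
      z * (u * (+ suc (l ℕ.+ N ℕ.+ n) * s (l ℕ.+ suc N) n)
           - v * ((+ suc j * c n (suc j)) * (+ suc j * c (suc j ℕ.+ suc j) (suc j))))
        ≡⟨ cong₂ (λ x y → z * (u * x - v * y))
             (trans (cong (λ t → + suc (l ℕ.+ N ℕ.+ n) * s t n) (ℕₚ.+-suc l N)) (s-sucˡ (l ℕ.+ N) n))
             (cong₂ _*_ (c-lower n j) (c-central j)) ⟩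
      z * (u * (+ 2 * (1ℤ + + 2 * + (l ℕ.+ N)) * p) - v * (((+ n - + j) * x₀) * (+ 2 * (1ℤ + + 2 * + j) * y₀)))
        ≡⟨ solve 7 (λ z j N l p x₀ y₀ →
              let n = j :+ (con 1ℤ :+ N) in
              z :* ((con 1ℤ :+ con (+ 2) :* j) :* (con 1ℤ :+ N) :* x₀ :* y₀
                  :* (con (+ 2) :* (con 1ℤ :+ con (+ 2) :* (l :+ N)) :* p)
                :- (con 1ℤ :+ con (+ 2) :* (l :+ N)) :* p
                  :* (((n :- j) :* x₀) :* (con (+ 2) :* (con 1ℤ :+ con (+ 2) :* j) :* y₀)))
              := con 0ℤ)
             refl z (+ j) (+ N) (+ l) p x₀ y₀ ⟩
      0ℤ ∎
      where
      p x₀ y₀ u v z : ℤ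
      p = s (l ℕ.+ N) n
      x₀ = c n j
      y₀ = c (j ℕ.+ j) j
      u = (1ℤ + + 2 * + j) * + suc N * x₀ * y₀
      v = (1ℤ + + 2 * + (l ℕ.+ N)) * p
      z = + 2 * -1ℤ ^ j * s n l

    -- As j < n, all three factors are positive; writing them as successors makes `β` visibly
    -- nonzero, so that it can be cancelled.
    β-positive : β (n ℕ.+ n) j ≡
      + suc (j ℕ.+ N ℕ.+ N ℕ.+ l ℕ.+ 1) * + suc (j ℕ.+ j) * + suc (N ℕ.+ N ℕ.+ 1)
    β-positive = solve 3 (λ j N l →
      let n = j :+ (con 1ℤ :+ N) in
      (n :+ n :+ l :- j) :* (con 1ℤ :+ con (+ 2) :* j) :* (n :+ n :- con (+ 2) :* j)
      := (con 1ℤ :+ (j :+ N :+ N :+ l :+ con 1ℤ)) :* (con 1ℤ :+ (j :+ j)) :* (con 1ℤ :+ (N :+ N :+ con 1ℤ)))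
      refl (+ j) (+ N) (+ l)

  -- Induction on N = n - j makes the descent on j structural. Sum and closed form obey the same
  -- recurrence and agree at j + 1, so they agree at j once `β` is cancelled.
  weightedSum-U : ∀ N j n → j ℕ.+ N ≡ n → weightedSum (n ℕ.+ n) (U j) ≡ closedForm n j N
  weightedSum-U zero j n eq with trans (sym (ℕₚ.+-identityʳ j)) eq
  ... | refl = weightedSum-U-diagonal j
  weightedSum-U (suc N) j n refl = *-cancelˡ-≡
    (+ suc (j ℕ.+ N ℕ.+ N ℕ.+ l ℕ.+ 1) * + suc (j ℕ.+ j) * + suc (N ℕ.+ N ℕ.+ 1)) _ _
    (subst (λ b → b * weightedSum (n ℕ.+ n) (U j) ≡ b * closedForm n j (suc N)) (β-positive j N)
      (+-cancelˡ-≡ (α (n ℕ.+ n) j * closedForm n (suc j) N) _ _ (begin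
        α (n ℕ.+ n) j * closedForm n (suc j) N + β (n ℕ.+ n) j * weightedSum (n ℕ.+ n) (U j)
          ≡⟨ cong (λ t → α (n ℕ.+ n) j * t + β (n ℕ.+ n) j * weightedSum (n ℕ.+ n) (U j))
               (weightedSum-U N (suc j) n (sym (ℕₚ.+-suc j N))) ⟨
        α (n ℕ.+ n) j * weightedSum (n ℕ.+ n) (U (suc j)) + β (n ℕ.+ n) j * weightedSum (n ℕ.+ n) (U j)
          ≡⟨ weightedSum-U-rec (n ℕ.+ n) j ⟩
        0ℤ
          ≡⟨ closedForm-rec j N ⟨
        α (n ℕ.+ n) j * closedForm n (suc j) N + β (n ℕ.+ n) j * closedForm n j (suc N) ∎)))

  S∣weightedSum-U : ∀ n j → s n l ∣ weightedSum (n ℕ.+ n) (U j)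
  S∣weightedSum-U n j with j ℕₚ.≤? n
  ... | yes j≤n with ℕₚ.m≤n⇒∃[o]m+o≡n j≤n
  ...   | N , eq = subst (s n l ∣_) (sym (weightedSum-U N j n eq))
    (∣m⇒∣m*n (c n j * c (j ℕ.+ j) j) (∣n⇒∣m*n (-1ℤ ^ j) (divides (s (l ℕ.+ N) n) (*-comm (s n l) _))))
  -- Indices j > n do arise, because the expansion raises j by up to 2n. Every term then vanishes:
  -- a, b ≥ j > n would contradict a + b = 2n.
  S∣weightedSum-U n j | no j≰n =
    divides 0ℤ (antidiagonal-zero (n ℕ.+ n) λ a b eq → cong (_* w a b) (vanish a b eq))
    where
    n<j : n ℕ.< j
    n<j = ℕₚ.≰⇒> j≰n
    vanish : ∀ a b → a ℕ.+ b ≡ n ℕ.+ n → U j a b ≡ 0ℤ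
    vanish a b eq with a ℕₚ.<? j
    ... | yes a<j = U-<ˡ b a<j
    ... | no a≮j with b ℕₚ.<? j
    ...   | yes b<j = U-<ʳ a b<j
    ...   | no b≮j = contradiction eq (ℕₚ.>⇒≢
      (ℕₚ.+-mono-< (ℕₚ.<-≤-trans n<j (ℕₚ.≮⇒≥ a≮j)) (ℕₚ.<-≤-trans n<j (ℕₚ.≮⇒≥ b≮j))))

  -- Powers of the binomial coefficient

  CU : ℕ → ℕ → ℕ → ℕ → ℤ
  CU t j a b = c (a ℕ.+ b) a ^ t * U j a b

  -- One power of the binomial is removed by `C*V-expansion`, at the price of higher indices; its
  -- coefficients depend on N = a + b only, so the two sums can be exchanged.
  weightedSum-CU-suc : ∀ N t j →
    weightedSum N (CU (suc t) j) ≡ ∑[ u ≤ N ] (c N j * c (j ℕ.+ toℕ u) j * weightedSum N (CU t (j ℕ.+ toℕ u)))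
  weightedSum-CU-suc N t j = begin
    antidiagonal N (λ a b → CU (suc t) j a b * w a b)
      ≡⟨ antidiagonal-cong N pointwise ⟩
    antidiagonal N (λ a b → ∑[ u ≤ N ] (κ (toℕ u) * (CU t (j ℕ.+ toℕ u) a b * w a b)))
      ≡⟨ ∑-comm {suc N} {suc N} (λ k u →
           κ (toℕ u) * (CU t (j ℕ.+ toℕ u) (toℕ k) (N ℕ.∸ toℕ k) * w (toℕ k) (N ℕ.∸ toℕ k))) ⟩
    ∑[ u ≤ N ] antidiagonal N (λ a b → κ (toℕ u) * (CU t (j ℕ.+ toℕ u) a b * w a b))
      ≡⟨ sum-cong-≗ {suc N} (λ u → *-distribˡ-sum {suc N} (κ (toℕ u))
           (λ k → CU t (j ℕ.+ toℕ u) (toℕ k) (N ℕ.∸ toℕ k) * w (toℕ k) (N ℕ.∸ toℕ k))) ⟨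
    ∑[ u ≤ N ] (κ (toℕ u) * weightedSum N (CU t (j ℕ.+ toℕ u))) ∎
    where
    κ : ℕ → ℤ
    κ u = c N j * c (j ℕ.+ u) j
    pointwise : ∀ a b → a ℕ.+ b ≡ N → CU (suc t) j a b * w a b ≡
      ∑[ u ≤ N ] (κ (toℕ u) * (CU t (j ℕ.+ toℕ u) a b * w a b))
    pointwise a b refl = begin
      K * K ^ t * (K * V j) * w a b
        -- One `K` is spent on the expansion; another is kept to turn each resulting `V i` back into
        -- `U i`.
        ≡⟨ solve 4 (λ k kt v w → k :* kt :* (k :* v) :* w := (kt :* k :* w) :* (k :* v)) refl
             K (K ^ t) (V j) (w a b) ⟩
      (K ^ t * K * w a b) * (K * V j)
        ≡⟨ cong ((K ^ t * K * w a b) *_) (C*V-expansion a b j N (ℕₚ.m≤m+n a b)) ⟩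
      (K ^ t * K * w a b) * ∑[ u ≤ N ] (κ (toℕ u) * V (j ℕ.+ toℕ u))
        ≡⟨ *-distribˡ-sum {suc N} (K ^ t * K * w a b) (λ u → κ (toℕ u) * V (j ℕ.+ toℕ u)) ⟩
      ∑[ u ≤ N ] ((K ^ t * K * w a b) * (κ (toℕ u) * V (j ℕ.+ toℕ u)))
        ≡⟨ sum-cong-≗ {suc N} (λ u → solve 5
             (λ k kt v w x → (kt :* k :* w) :* (x :* v) := x :* (kt :* (k :* v) :* w)) refl
             K (K ^ t) (V (j ℕ.+ toℕ u)) (w a b) (κ (toℕ u))) ⟩
      ∑[ u ≤ N ] (κ (toℕ u) * (CU t (j ℕ.+ toℕ u) a b * w a b)) ∎
      where
      K : ℤ
      K = c (a ℕ.+ b) a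
      V : ℕ → ℤ
      V i = c a i * c b i

  -- Induction on t for all j at once, as the expansion raises j.
  S∣weightedSum-CU : ∀ n t j → s n l ∣ weightedSum (n ℕ.+ n) (CU t j)
  S∣weightedSum-CU n zero j = subst (s n l ∣_)
    (antidiagonal-cong (n ℕ.+ n) (λ a b _ → cong (_* w a b) (sym (*-identityˡ (U j a b))))) (S∣weightedSum-U n j)
  S∣weightedSum-CU n (suc t) j = subst (s n l ∣_) (sym (weightedSum-CU-suc (n ℕ.+ n) t j))
    (∣-sum (suc (n ℕ.+ n)) _ (λ u →
      ∣n⇒∣m*n (c (n ℕ.+ n) j * c (j ℕ.+ toℕ u) j) (S∣weightedSum-CU n t (j ℕ.+ toℕ u))))

  -- `U 0` already carries one factor C(a + b, a), and C(a, 0) = C(b, 0) = 1, so the exponent t + 1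
  -- corresponds to `CU t 0`.
  Ψ≡weightedSum : ∀ N t → Ψ N (suc t) l ≡ weightedSum N (CU t 0)
  Ψ≡weightedSum N t = antidiagonal-cong N
    {λ a b → -1ℤ ^ a * c N a ^ suc t * s a l * s b l} {λ a b → CU t 0 a b * w a b}
    λ { a b refl → solve 5 (λ σ k kt x y → σ :* (k :* kt) :* x :* y := kt :* (k :* con 1ℤ) :* (σ :* (x :* y))) refl
      (-1ℤ ^ a) (c (a ℕ.+ b) a) (c (a ℕ.+ b) a ^ t) (s a l) (s b l) }

theorem3 : (n l m : ℕ) → .{{_ : NonZero m}} → + S n l ∣ Ψ (2 ℕ.* n) m l
-- Positivity of `m` enters here, through `m` = `suc (pred m)`.
theorem3 n l m = subst (λ m → + S n l ∣ Ψ (2 ℕ.* n) m l) (ℕₚ.suc-pred m)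
  (subst (s n l ∣_) (sym (Ψ≡weightedSum l (2 ℕ.* n) (ℕ.pred m)))
  (subst (λ N → s n l ∣ weightedSum l N (CU l (ℕ.pred m) 0)) (cong (n ℕ.+_) (sym (ℕₚ.+-identityʳ n)))
     (S∣weightedSum-CU l n (ℕ.pred m) 0)))
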